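{- For all integers $n,h,b\ge0$, $E_n(h,b)=F_n(h,b)$, where $E_n(h,b)=|\mathcal{B}^{(h,b)}_{n+1}(213)|$ and $F_n(h,b)=|\mathcal{G}(n;h,b)|$.
   Context: For integers $h,b\ge0$, a permutation $\pi\in\mathfrak{S}_{n+1}$ is an $(h,b)$-ballot permutation if the lattice path starting at $(0,h)$ whose $i$th step ($i\in[n]$) is $(1,1)$ if $\pi_i<\pi_{i+1}$ and $(1,-1)$ if $\pi_i>\pi_{i+1}$ ends at $(n,b)$ and never goes below the $x$-axis. $\mathcal{B}^{(h,b)}_{n+1}(213)$ is the set of $(h,b)$-ballot permutations in $\mathfrak{S}_{n+1}$ with no subsequence order-isomorphic to $213$. A Gessel walk is a lattice path confined to $\mathbb{N}^2$ with steps from $\{(0,1),(0,-1),(1,1),(-1,-1)\}$; $\mathcal{G}(n;h,b)$ is the set of $n$-step Gessel walks from $(0,h)$ to $(0,b)$. -}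

module Defs where

open import Data.Bool.Base using (if_then_else_)
open import Data.Fin.Base using (Fin; zero; suc; inject₁; punchIn; _<_)
open import Data.Fin.Permutation
  using (Permutation′; _⟨$⟩ʳ_; insert; remove; insert-punchIn; insert-remove)
  renaming (_≈_ to _≈ₚ_; id to idₚ)
open import Data.Fin.Properties using (_<?_; any?; punchIn-injective)
open import Data.Integer.Base as ℤ using (ℤ; +_; 0ℤ; 1ℤ; -1ℤ)
import Data.Integer.Properties as ℤ
open import Data.List.Base as List using (List; allFin; cartesianProductWith; filter; length)
import Data.List.Membership.Propositional.Properties as ∈
import Data.List.Membership.Setoid.Properties as ∈ₛ
open import Data.List.Relation.Unary.All as ListAll using ()
open import Data.List.Relation.Unary.AllPairs as AllPairs using ()
open import Data.List.Relation.Unary.Any using (here; there)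
open import Data.List.Relation.Unary.Enumerates.Setoid using (IsEnumeration)
open import Data.List.Relation.Unary.Unique.Setoid using (Unique)
import Data.List.Relation.Unary.Unique.Propositional.Properties as Unique
import Data.List.Relation.Unary.Unique.Setoid.Properties as Uniqueₛ
open import Data.Nat.Base using (ℕ; zero; suc)
open import Data.Product.Base using (∃; _×_; _,_; proj₁; proj₂)
open import Data.Product.Properties using (≡-dec)
open import Data.Vec.Base as Vec using (Vec; []; _∷_; last; tabulate)
open import Data.Vec.Properties using (tabulate-cong; ∷-injective)
open import Data.Vec.Relation.Unary.All using (All; all?)
open import Level using (0ℓ)
open import Relation.Binary.Bundles using (Setoid)
open import Relation.Binary.Definitions using (DecidableEquality; _Respects_)
open import Relation.Binary.PropositionalEquality
  using (_≡_; refl; sym; trans; cong; cong₂; subst; subst₂; setoid)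
open import Relation.Nullary using (¬_; does)
open import Relation.Nullary.Decidable using (¬?; _×-dec_)
open import Relation.Unary using (Pred; Decidable)

-- Permutations form a setoid rather than a set with _≡_ (an inverse pair
-- contains proofs about functions), so finiteness is phrased for setoids.

record Enumeration (S : Setoid 0ℓ 0ℓ) : Set where
  open Setoid S using (Carrier)
  field
    elements : List Carrier
    complete : IsEnumeration S elements
    distinct : Unique S elements

open Enumeration public

-- The number of elements of S, up to its equality, that satisfy P.

card : ∀ {S} → Enumeration S → {P : Pred (Setoid.Carrier S) 0ℓ} → Decidable P → ℕ
card enum P? = length (filter P? (elements enum))

Point : Set
Point = ℤ × ℤ

_≟ₚ_ : DecidableEquality Point
_≟ₚ_ = ≡-dec ℤ._≟_ ℤ._≟_

infixl 6 _⊕_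

_⊕_ : Point → Point → Point
(x , y) ⊕ (u , v) = x ℤ.+ u , y ℤ.+ v

-- All points visited by a path, the starting point included.

vertices : ∀ {n} → Point → Vec Point n → Vec Point (suc n)
vertices p []       = p ∷ []
vertices p (s ∷ ss) = p ∷ vertices (p ⊕ s) ss

NotBelowAxis : Pred Point 0ℓ
NotBelowAxis (x , y) = 0ℤ ℤ.≤ y

notBelowAxis? : Decidable NotBelowAxis
notBelowAxis? (x , y) = 0ℤ ℤ.≤? y

InQuadrant : Pred Point 0ℓ
InQuadrant (x , y) = 0ℤ ℤ.≤ x × 0ℤ ℤ.≤ y

inQuadrant? : Decidable InQuadrant
inQuadrant? (x , y) = 0ℤ ℤ.≤? x ×-dec 0ℤ ℤ.≤? y

-- With 0-based indices π_{i+1} is π ⟨$⟩ʳ i.  Consecutive values of a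
-- permutation differ, so the else branch is exactly the case of a descent.

ballotStep : ∀ {n} → Permutation′ (suc n) → Fin n → Point
ballotStep π i =
  if does ((π ⟨$⟩ʳ inject₁ i) <? (π ⟨$⟩ʳ suc i))
  then (1ℤ , 1ℤ)
  else (1ℤ , -1ℤ)

ballotPath : ∀ {n} → ℕ → Permutation′ (suc n) → Vec Point (suc n)
ballotPath h π = vertices (0ℤ , + h) (tabulate (ballotStep π))

IsBallot : ∀ {n} → ℕ → ℕ → Pred (Permutation′ (suc n)) 0ℓ
IsBallot {n} h b π =
  last (ballotPath h π) ≡ (+ n , + b) × All NotBelowAxis (ballotPath h π)

Contains213 : ∀ {n} → Pred (Permutation′ n) 0ℓ
Contains213 π = ∃ λ i → ∃ λ j → ∃ λ k →
  i < j × j < k × (π ⟨$⟩ʳ j) < (π ⟨$⟩ʳ i) × (π ⟨$⟩ʳ i) < (π ⟨$⟩ʳ k)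

𝓑213 : ∀ n → ℕ → ℕ → Pred (Permutation′ (suc n)) 0ℓ
𝓑213 n h b π = IsBallot h b π × ¬ Contains213 π

contains213? : ∀ {n} → Decidable (Contains213 {n})
contains213? π = any? λ i → any? λ j → any? λ k →
  i <? j ×-dec j <? k ×-dec
  (π ⟨$⟩ʳ j) <? (π ⟨$⟩ʳ i) ×-dec (π ⟨$⟩ʳ i) <? (π ⟨$⟩ʳ k)

𝓑213? : ∀ n h b → Decidable (𝓑213 n h b)
𝓑213? n h b π =
  (last (ballotPath h π) ≟ₚ (+ n , + b) ×-dec all? notBelowAxis? (ballotPath h π))
  ×-dec ¬? (contains213? π)

PermutationSetoid : ℕ → Setoid 0ℓ 0ℓ
PermutationSetoid n = record
  { Carrier       = Permutation′ n
  ; _≈_           = _≈ₚ_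
  ; isEquivalence = record
    { refl  = λ _ → refl
    ; sym   = λ p i → sym (p i)
    ; trans = λ p q i → trans (p i) (q i)
    }
  }

-- Membership depends on the underlying function only, so that card counts
-- a well-defined subset of the setoid.

ballotStep-resp : ∀ {n} {π ρ : Permutation′ (suc n)} →
                  π ≈ₚ ρ → ∀ i → ballotStep π i ≡ ballotStep ρ i
ballotStep-resp π≈ρ i =
  cong₂ (λ x y → if does (x <? y) then (1ℤ , 1ℤ) else (1ℤ , -1ℤ))
        (π≈ρ (inject₁ i)) (π≈ρ (suc i))

𝓑213-resp : ∀ n h b → 𝓑213 n h b Respects _≈ₚ_
𝓑213-resp n h b {π} {ρ} π≈ρ (ballot , avoids) =
  subst (λ ss → last (vertices (0ℤ , + h) ss) ≡ (+ n , + b)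
              × All NotBelowAxis (vertices (0ℤ , + h) ss))
        (tabulate-cong (ballotStep-resp {π = π} {ρ} π≈ρ)) ballot ,
  λ { (i , j , k , i<j , j<k , ρj<ρi , ρi<ρk) →
      avoids (i , j , k , i<j , j<k ,
        subst₂ _<_ (sym (π≈ρ j)) (sym (π≈ρ i)) ρj<ρi ,
        subst₂ _<_ (sym (π≈ρ i)) (sym (π≈ρ k)) ρi<ρk) }

-- A permutation of n + 1 values is a first value together with the
-- standardisation of the remaining word.

insert-cong : ∀ {n} {v w : Fin (suc n)} {π ρ : Permutation′ n} →
              v ≡ w → π ≈ₚ ρ → insert zero v π ≈ₚ insert zero w ρ
insert-cong v≡w π≈ρ zero = v≡w
insert-cong {v = v} {π = π} {ρ} refl π≈ρ (suc i) =
  trans (insert-punchIn zero v π i)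
        (trans (cong (punchIn v) (π≈ρ i)) (sym (insert-punchIn zero v ρ i)))

insert-injective : ∀ {n} {v w : Fin (suc n)} {π ρ : Permutation′ n} →
                   insert zero v π ≈ₚ insert zero w ρ → v ≡ w × π ≈ₚ ρ
insert-injective {v = v} {w} {π} {ρ} eq with eq zero
... | refl = refl , λ i → punchIn-injective v _ _
  (trans (sym (insert-punchIn zero v π i))
         (trans (eq (suc i)) (insert-punchIn zero v ρ i)))

allPermutations : ∀ n → List (Permutation′ n)
allPermutations zero    = List.[ idₚ ]
allPermutations (suc n) =
  cartesianProductWith (insert zero) (allFin (suc n)) (allPermutations n)

permutations : ∀ n → Enumeration (PermutationSetoid n)
permutations n = record
  { elements = allPermutations n
  ; complete = allPermutations-complete n
  ; distinct = allPermutations-distinct n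
  }
  where
  allPermutations-complete : ∀ n → IsEnumeration (PermutationSetoid n) (allPermutations n)
  allPermutations-complete zero    π = here λ ()
  allPermutations-complete (suc n) π =
    ∈ₛ.∈-resp-≈ (PermutationSetoid (suc n))
      {x = insert zero (π ⟨$⟩ʳ zero) (remove zero π)} {y = π} (insert-remove zero π)
      (∈ₛ.∈-cartesianProductWith⁺ (setoid _) (PermutationSetoid n) (PermutationSetoid (suc n))
        (λ {v} {w} {π} {ρ} → insert-cong {π = π} {ρ})
        (∈.∈-allFin (π ⟨$⟩ʳ zero))
        (allPermutations-complete n (remove zero π)))

  allPermutations-distinct : ∀ n → Unique (PermutationSetoid n) (allPermutations n)
  allPermutations-distinct zero    = ListAll.[] AllPairs.∷ AllPairs.[]
  allPermutations-distinct (suc n) =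
    Uniqueₛ.cartesianProductWith⁺ (setoid _) (PermutationSetoid n) (PermutationSetoid (suc n))
      (insert zero) (λ {v} {w} {π} {ρ} → insert-injective {π = π} {ρ})
      (Unique.allFin⁺ (suc n)) (allPermutations-distinct n)

E : ℕ → ℕ → ℕ → ℕ
E n h b = card (permutations (suc n)) (𝓑213? n h b)

data GesselStep : Set where
  N S NE SW : GesselStep

⟦_⟧ : GesselStep → Point
⟦ N  ⟧ = 0ℤ  , 1ℤ
⟦ S  ⟧ = 0ℤ  , -1ℤ
⟦ NE ⟧ = 1ℤ  , 1ℤ
⟦ SW ⟧ = -1ℤ , -1ℤ

walk : ∀ {n} → ℕ → Vec GesselStep n → Vec Point (suc n)
walk h ss = vertices (0ℤ , + h) (Vec.map ⟦_⟧ ss)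

-- The starting point is fixed, so a walk is determined by its steps.

𝓖 : ∀ n → ℕ → ℕ → Pred (Vec GesselStep n) 0ℓ
𝓖 n h b ss = last (walk h ss) ≡ (0ℤ , + b) × All InQuadrant (walk h ss)

𝓖? : ∀ n h b → Decidable (𝓖 n h b)
𝓖? n h b ss = last (walk h ss) ≟ₚ (0ℤ , + b) ×-dec all? inQuadrant? (walk h ss)

allSteps : List GesselStep
allSteps = N List.∷ S List.∷ NE List.∷ SW List.∷ List.[]

allStepWords : ∀ n → List (Vec GesselStep n)
allStepWords zero    = List.[ [] ]
allStepWords (suc n) = cartesianProductWith _∷_ allSteps (allStepWords n)

stepWords : ∀ n → Enumeration (setoid (Vec GesselStep n))
stepWords n = record
  { elements = allStepWords n
  ; complete = allStepWords-complete n
  ; distinct = allStepWords-distinct n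
  }
  where
  allSteps-complete : IsEnumeration (setoid GesselStep) allSteps
  allSteps-complete N  = here refl
  allSteps-complete S  = there (here refl)
  allSteps-complete NE = there (there (here refl))
  allSteps-complete SW = there (there (there (here refl)))

  allSteps-distinct : Unique (setoid GesselStep) allSteps
  allSteps-distinct =
    ((λ ()) ListAll.∷ (λ ()) ListAll.∷ (λ ()) ListAll.∷ ListAll.[]) AllPairs.∷
    ((λ ()) ListAll.∷ (λ ()) ListAll.∷ ListAll.[]) AllPairs.∷
    ((λ ()) ListAll.∷ ListAll.[]) AllPairs.∷
    ListAll.[] AllPairs.∷
    AllPairs.[]

  allStepWords-complete : ∀ n → IsEnumeration (setoid (Vec GesselStep n)) (allStepWords n)
  allStepWords-complete zero    []       = here refl
  allStepWords-complete (suc n) (s ∷ ss) =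
    ∈.∈-cartesianProductWith⁺ _∷_ (allSteps-complete s) (allStepWords-complete n ss)

  allStepWords-distinct : ∀ n → Unique (setoid (Vec GesselStep n)) (allStepWords n)
  allStepWords-distinct zero    = ListAll.[] AllPairs.∷ AllPairs.[]
  allStepWords-distinct (suc n) =
    Unique.cartesianProductWith⁺ _∷_ ∷-injective
      allSteps-distinct (allStepWords-distinct n)

F : ℕ → ℕ → ℕ → ℕ
F n h b = card (stepWords n) (𝓖? n h b)

{-# OPTIONS --safe #-}
module Submission where

-- Build a permutation by prepending values.  Prepending v to a 213-avoiding ρ
-- keeps it 213-avoiding iff v is a cut of ρ: no entry below v precedes an entry
-- that is at least v.  If ρ has c cuts besides the largest value, number them
-- 0, …, c − 1 and the largest value c; prepending cut number j leaves j + 1 such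
-- cuts, and the new step is a descent for j = c and an ascent for j < c.
-- Weighting ρ by the binomial coefficient (c − 1) C k, the hockey-stick identity
-- and Pascal's rule turn these transitions into k ↦ k or k + 1 for an ascent and
-- k ↦ k or k − 1 for a descent.  This is the recurrence for Gessel walks from
-- (k , h) to (0 , b), and for k = 0 all weights are 1.

open import Defs
open import Data.Bool.Base using (true; false; if_then_else_)
open import Data.Fin.Base as Fin using (Fin; zero; suc; toℕ; fromℕ; fromℕ<; inject₁; punchIn)
open import Data.Fin.Permutation using (Permutation′; _⟨$⟩ʳ_; _⟨$⟩ˡ_; inverseʳ; insert; insert-punchIn) renaming (id to idₚ)
open import Data.Fin.Properties as Fin using (all?; toℕ<n; toℕ-fromℕ; toℕ-fromℕ<; toℕ-inject₁; punchIn-cancel-≤)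
open import Data.Integer.Base as ℤ using (+_; 0ℤ; 1ℤ; -1ℤ; +≤+)
import Data.Integer.Properties as ℤ
open import Data.List.Base as List
  using (List; []; _∷_; _++_; map; filter; length; allFin; cartesianProductWith)
open import Data.Nat.Base
open import Data.Nat.Combinatorics using (_C_; nCn≡1; nCk≡nC[n∸k]; k>n⇒nCk≡0; nCk+nC[k+1]≡[n+1]C[k+1])
open import Data.Nat.Properties
open import Algebra.Properties.CommutativeSemigroup +-commutativeSemigroup using (interchange)
open import Algebra.Properties.AbelianGroup ℤ.+-0-abelianGroup
  using () renaming (∙-cancelˡ to +ℤ-cancelˡ)
open import Data.Product.Base using (_×_; _,_; proj₁; proj₂)
open import Data.Sum.Base using (inj₁; inj₂)
open import Data.Vec.Base as Vec using (Vec; []; _∷_; last)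
open import Data.Vec.Properties using (tabulate-cong)
open import Data.Vec.Relation.Unary.All as All using (All; []; _∷_)
open import Function.Base using (_∘_; id)
open import Function.Bundles using (_⇔_; mk⇔; Equivalence)
open import Level using (0ℓ)
open import Relation.Binary.PropositionalEquality
open import Relation.Nullary using (¬_; Dec; yes; no; does; contradiction)
open import Relation.Nullary.Decidable using (_×-dec_; _→-dec_; does-⇔; dec-true; dec-false)
open import Relation.Unary using (Pred; Decidable)

open Equivalence using (to; from)

private
  variable
    A B : Set
    P Q : Pred ℕ 0ℓ

-- Indicators and finite sums

χ : Dec A → ℕ
χ a? = if does a? then 1 else 0

χ-cong : A ⇔ B → (a? : Dec A) (b? : Dec B) → χ a? ≡ χ b?
χ-cong A⇔B a? b? = cong (if_then 1 else 0) (does-⇔ A⇔B a? b?)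

χ-true : (a? : Dec A) → A → χ a? ≡ 1
χ-true (yes _) _ = refl
χ-true (no ¬a) a = contradiction a ¬a

χ-false : (a? : Dec A) → ¬ A → χ a? ≡ 0
χ-false (yes a) ¬a = contradiction a ¬a
χ-false (no _)  _  = refl

χ-*-cong : (a? : Dec A) {m n : ℕ} → (A → m ≡ n) → χ a? * m ≡ χ a? * n
χ-*-cong (yes a) eq = cong (1 *_) (eq a)
χ-*-cong (no _)  _  = refl

χ-× : (a? : Dec A) (b? : Dec B) → χ (a? ×-dec b?) ≡ χ a? * χ b?
χ-× (yes _) (yes _) = refl
χ-× (yes _) (no _)  = refl
χ-× (no _)  _       = refl

∑ : List A → (A → ℕ) → ℕ
∑ []       f = 0
∑ (x ∷ xs) f = f x + ∑ xs f

∑-cong : ∀ (xs : List A) {f g : A → ℕ} → (∀ x → f x ≡ g x) → ∑ xs f ≡ ∑ xs g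
∑-cong []       f≗g = refl
∑-cong (x ∷ xs) f≗g = cong₂ _+_ (f≗g x) (∑-cong xs f≗g)

∑-zero : ∀ (xs : List A) {f : A → ℕ} → (∀ x → f x ≡ 0) → ∑ xs f ≡ 0
∑-zero []       f≗0 = refl
∑-zero (x ∷ xs) f≗0 = cong₂ _+_ (f≗0 x) (∑-zero xs f≗0)

∑-+ : ∀ (xs : List A) (f g : A → ℕ) → ∑ xs (λ x → f x + g x) ≡ ∑ xs f + ∑ xs g
∑-+ []       f g = refl
∑-+ (x ∷ xs) f g = trans (cong (_+_ (f x + g x)) (∑-+ xs f g)) (interchange (f x) (g x) _ _)

∑-++ : ∀ (xs ys : List A) {f : A → ℕ} → ∑ (xs ++ ys) f ≡ ∑ xs f + ∑ ys f
∑-++ []       ys     = refl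
∑-++ (x ∷ xs) ys {f} = trans (cong (_+_ (f x)) (∑-++ xs ys)) (sym (+-assoc (f x) _ _))

∑-map : ∀ (g : A → B) (xs : List A) {f : B → ℕ} → ∑ (map g xs) f ≡ ∑ xs (f ∘ g)
∑-map g []           = refl
∑-map g (x ∷ xs) {f} = cong (_+_ (f (g x))) (∑-map g xs)

∑-comm : ∀ (xs : List A) (ys : List B) (f : A → B → ℕ) →
         ∑ xs (λ x → ∑ ys (f x)) ≡ ∑ ys (λ y → ∑ xs (λ x → f x y))
∑-comm []       ys f = sym (∑-zero ys λ _ → refl)
∑-comm (x ∷ xs) ys f =
  trans (cong (_+_ (∑ ys (f x))) (∑-comm xs ys f)) (sym (∑-+ ys (f x) _))

∑-cartesianProductWith : ∀ {C : Set} (g : A → B → C) xs ys {f : C → ℕ} →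
  ∑ (cartesianProductWith g xs ys) f ≡ ∑ xs (λ x → ∑ ys (f ∘ g x))
∑-cartesianProductWith g []       ys = refl
∑-cartesianProductWith g (x ∷ xs) ys =
  trans (∑-++ (map (g x) ys) _)
        (cong₂ _+_ (∑-map (g x) ys) (∑-cartesianProductWith g xs ys))

length-filter-∑ : ∀ {P : Pred A 0ℓ} (P? : Decidable P) xs →
                  length (filter P? xs) ≡ ∑ xs (χ ∘ P?)
length-filter-∑ P? []       = refl
length-filter-∑ P? (x ∷ xs) with does (P? x)
... | true  = cong suc (length-filter-∑ P? xs)
... | false = length-filter-∑ P? xs

-- Isolating the last index separates the one prepended value that creates a descent, the largest,
-- from the values `inject₁ i`.
∑-tabulate-last : ∀ n (g : Fin (suc n) → A) (f : A → ℕ) →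
  ∑ (List.tabulate g) f ≡ ∑ (List.tabulate (g ∘ inject₁)) f + f (g (fromℕ n))
∑-tabulate-last zero    g f = +-identityʳ _
∑-tabulate-last (suc n) g f =
  trans (cong (_+_ (f (g zero))) (∑-tabulate-last n (g ∘ suc) f)) (sym (+-assoc (f (g zero)) _ _))

-- Recursion at the upper end suits prefix counts: the term appended at `m` involves exactly the
-- count of the indices already summed.
∑< : ℕ → (ℕ → ℕ) → ℕ
∑< zero    f = 0
∑< (suc m) f = ∑< m f + f m

∑-tabulate : ∀ n (g : Fin n → A) (f : A → ℕ) (t : ℕ → ℕ) →
             (∀ i → f (g i) ≡ t (toℕ i)) → ∑ (List.tabulate g) f ≡ ∑< n t
∑-tabulate zero    g f t eq = refl
∑-tabulate (suc n) g f t eq = trans (∑-tabulate-last n g f)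
  (cong₂ _+_
    (∑-tabulate n (g ∘ inject₁) f t (λ i → trans (eq (inject₁ i)) (cong t (toℕ-inject₁ i))))
    (trans (eq (fromℕ n)) (cong t (toℕ-fromℕ n))))

∑<-*ˡ : ∀ c m (f : ℕ → ℕ) → ∑< m (λ u → c * f u) ≡ c * ∑< m f
∑<-*ˡ c zero    f = sym (*-zeroʳ c)
∑<-*ˡ c (suc m) f =
  trans (cong (_+ c * f m) (∑<-*ˡ c m f)) (sym (*-distribˡ-+ c (∑< m f) (f m)))

-- Counting elements below a bound, and binomial coefficients

nC0≡1 : ∀ n → n C 0 ≡ 1
nC0≡1 n = trans (nCk≡nC[n∸k] {0} {n} z≤n) (nCn≡1 n)

count : Decidable P → ℕ → ℕ
count P? m = ∑< m (χ ∘ P?)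

count-cong : (P? : Decidable P) (Q? : Decidable Q) → ∀ m →
             (∀ {u} → u < m → P u ⇔ Q u) → count P? m ≡ count Q? m
count-cong P? Q? zero    eq = refl
count-cong P? Q? (suc m) eq =
  cong₂ _+_ (count-cong P? Q? m (eq ∘ m<n⇒m<1+n)) (χ-cong (eq (n<1+n m)) (P? m) (Q? m))

-- Indices beyond `v` contribute nothing, so `m` can be lowered to `suc v`, where the condition
-- `u ≤ v` holds automatically.
count-truncate : (P? : Decidable P) (Q? : Decidable Q) → ∀ v m → v < m →
                 (∀ {u} → u < m → P u ⇔ (u ≤ v × Q u)) → count P? m ≡ count Q? (suc v)
count-truncate P? Q? v (suc m) v<1+m eq with m≤n⇒m<n∨m≡n (s≤s⁻¹ v<1+m)
... | inj₁ v<m = trans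
  (cong₂ _+_ (count-truncate P? Q? v m v<m (eq ∘ m<n⇒m<1+n))
             (χ-false (P? m) (λ Pm → <⇒≱ v<m (proj₁ (to (eq (n<1+n m)) Pm)))))
  (+-identityʳ _)
... | inj₂ refl = count-cong P? Q? (suc m) λ u<1+m →
  mk⇔ (proj₂ ∘ to (eq u<1+m)) (λ Qu → from (eq u<1+m) (s≤s⁻¹ u<1+m , Qu))

-- The j-th element counted contributes the binomial coefficient of j, so
-- this is the hockey-stick identity.

∑<-count-C : (P? : Decidable P) → ∀ k m →
  ∑< m (λ u → χ (P? u) * (count P? u C k)) ≡ count P? m C suc k
∑<-count-C P? k zero    = sym (k>n⇒nCk≡0 (z<s {k}))
∑<-count-C P? k (suc m) rewrite ∑<-count-C P? k m with does (P? m)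
... | false = trans (+-identityʳ _) (cong (_C suc k) (sym (+-identityʳ (count P? m))))
... | true  = begin
  c C suc k + (c C k + 0) ≡⟨ cong (_+_ (c C suc k)) (+-identityʳ _) ⟩
  c C suc k + c C k       ≡⟨ +-comm (c C suc k) _ ⟩
  c C k + c C suc k       ≡⟨ nCk+nC[k+1]≡[n+1]C[k+1] c k ⟩
  suc c C suc k           ≡⟨ cong (_C suc k) (+-comm 1 c) ⟩
  (c + 1) C suc k         ∎
  where
  open ≡-Reasoning
  c = count P? m

-- Cuts of a permutation

-- `punchIn v` fixes the values below `v` and raises the others by one, so no value crosses a
-- threshold at or below `v`.
punchIn-<⇔ : ∀ {n} (v : Fin (suc n)) x {u} → u ≤ toℕ v →
             toℕ (punchIn v x) < u ⇔ toℕ x < u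
punchIn-<⇔ zero    x       z≤n       = mk⇔ (λ ()) (λ ())
punchIn-<⇔ (suc v) zero    u≤v       = mk⇔ id id
punchIn-<⇔ (suc v) (suc x) z≤n       = mk⇔ (λ ()) (λ ())
punchIn-<⇔ (suc v) (suc x) (s≤s u≤v) =
  mk⇔ (s<s ∘ to (punchIn-<⇔ v x u≤v) ∘ s<s⁻¹) (s<s ∘ from (punchIn-<⇔ v x u≤v) ∘ s<s⁻¹)

<-punchIn⇔ : ∀ {n} (v : Fin (suc n)) x → toℕ v < toℕ (punchIn v x) ⇔ toℕ v ≤ toℕ x
<-punchIn⇔ zero    x       = mk⇔ (λ _ → z≤n) (λ _ → z<s)
<-punchIn⇔ (suc v) zero    = mk⇔ (λ ()) (λ ())
<-punchIn⇔ (suc v) (suc x) =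
  mk⇔ (s≤s ∘ to (<-punchIn⇔ v x) ∘ s<s⁻¹) (s<s ∘ from (<-punchIn⇔ v x) ∘ s≤s⁻¹)

punchIn-mono-<⇔ : ∀ {n} (v : Fin (suc n)) x y → punchIn v x Fin.< punchIn v y ⇔ x Fin.< y
punchIn-mono-<⇔ v x y = mk⇔
  (λ p → ≰⇒> (<⇒≱ p ∘ Fin.punchIn-mono-≤ v y x))
  (λ p → ≰⇒> (<⇒≱ p ∘ punchIn-cancel-≤ v y x))

-- Equivalently, the entries below `u` form a suffix of the word. Taking `u` in `ℕ` lets cuts of
-- permutations of different lengths be compared directly.
Cut : ∀ {n} → Permutation′ n → Pred ℕ 0ℓ
Cut π u = ∀ j k → j Fin.< k → toℕ (π ⟨$⟩ʳ j) < u → toℕ (π ⟨$⟩ʳ k) < u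

cut? : ∀ {n} (π : Permutation′ n) → Decidable (Cut π)
cut? π u = all? λ j → all? λ k →
  j Fin.<? k →-dec (toℕ (π ⟨$⟩ʳ j) <? u →-dec toℕ (π ⟨$⟩ʳ k) <? u)

-- The bound leaves out `n`, which is always a cut by `cut-n`: prepending it gives the descent,
-- which is treated separately.
cuts : ∀ {n} → Permutation′ n → ℕ
cuts {n} π = count (cut? π) n

cut-0 : ∀ {n} (π : Permutation′ n) → Cut π 0
cut-0 π j k _ ()

cut-n : ∀ {n} (π : Permutation′ n) → Cut π n
cut-n π j k _ _ = toℕ<n _

-- If the first entry were below `u`, the cut condition would put every entry below `u`, although
-- `u` itself occurs as an entry. Hence prepending a cut other than the largest value always creates
-- an ascent.
cut-≤-head : ∀ {n} (π : Permutation′ (suc n)) {u} → u < suc n → Cut π u →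
             u ≤ toℕ (π ⟨$⟩ʳ zero)
cut-≤-head π {u} u<1+n cut = ≮⇒≥ λ π₀<u →
  <-irrefl (trans (cong toℕ (inverseʳ π)) (toℕ-fromℕ< u<1+n))
           (below π₀<u (π ⟨$⟩ˡ fromℕ< u<1+n))
  where
  below : toℕ (π ⟨$⟩ʳ zero) < u → ∀ k → toℕ (π ⟨$⟩ʳ k) < u
  below π₀<u zero    = π₀<u
  below π₀<u (suc k) = cut zero (suc k) z<s π₀<u

count>0 : (P? : Decidable P) → P 0 → ∀ m → 0 < count P? (suc m)
count>0 P? P0 zero    = ≤-reflexive (sym (χ-true (P? 0) P0))
count>0 P? P0 (suc m) = ≤-trans (count>0 P? P0 m) (m≤m+n _ _)

-- The value 0 is always a cut and is within the bound, so `pred` never truncates.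
suc-pred-cuts : ∀ {n} (π : Permutation′ (suc n)) → suc (pred (cuts π)) ≡ cuts π
suc-pred-cuts {n} π = suc-pred _ ⦃ >-nonZero (count>0 (cut? π) (cut-0 π) n) ⦄

-- Prepending a value to a permutation

module _ {n} (v : Fin (suc n)) (ρ : Permutation′ n) where

  private
    π : Permutation′ (suc n)
    π = insert zero v ρ

  insert-< : ∀ i {u} → u ≤ toℕ v → toℕ (π ⟨$⟩ʳ suc i) < u ⇔ toℕ (ρ ⟨$⟩ʳ i) < u
  insert-< i u≤v rewrite insert-punchIn zero v ρ i = punchIn-<⇔ v (ρ ⟨$⟩ʳ i) u≤v

  <-insert : ∀ i → toℕ v < toℕ (π ⟨$⟩ʳ suc i) ⇔ toℕ v ≤ toℕ (ρ ⟨$⟩ʳ i)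
  <-insert i rewrite insert-punchIn zero v ρ i = <-punchIn⇔ v (ρ ⟨$⟩ʳ i)

  insert-mono-< : ∀ i j → (π ⟨$⟩ʳ suc i) Fin.< (π ⟨$⟩ʳ suc j) ⇔ (ρ ⟨$⟩ʳ i) Fin.< (ρ ⟨$⟩ʳ j)
  insert-mono-< i j rewrite insert-punchIn zero v ρ i | insert-punchIn zero v ρ j =
    punchIn-mono-<⇔ v (ρ ⟨$⟩ʳ i) (ρ ⟨$⟩ʳ j)

  cut-insert : ∀ {u} → u < suc n → Cut π u ⇔ (u ≤ toℕ v × Cut ρ u)
  cut-insert {u} u<1+n = mk⇔ fwd bwd
    where
    fwd : Cut π u → u ≤ toℕ v × Cut ρ u
    fwd cut = u≤v , λ j k j<k →
      to (insert-< k u≤v) ∘ cut (suc j) (suc k) (s<s j<k) ∘ from (insert-< j u≤v)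
      where u≤v = cut-≤-head π u<1+n cut
    bwd : u ≤ toℕ v × Cut ρ u → Cut π u
    -- Position zero carries `v`, which is not below `u`, so it imposes no condition.
    bwd (u≤v , cut) zero    k       _   v<u = contradiction u≤v (<⇒≱ v<u)
    bwd (u≤v , cut) (suc j) (suc k) j<k =
      from (insert-< k u≤v) ∘ cut j k (s<s⁻¹ j<k) ∘ to (insert-< j u≤v)

  -- The new first entry can only play the role of 2. A pattern using it is an entry of `ρ` below
  -- `v` followed by one that is at least `v`, which is a violation of the cut condition; every
  -- other pattern already lies in `ρ`.
  avoids-insert : (¬ Contains213 π) ⇔ ((¬ Contains213 ρ) × Cut ρ (toℕ v))
  avoids-insert = mk⇔
    (λ avoids →
      (λ { (i , j , k , i<j , j<k , ρj<ρi , ρi<ρk) →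
           avoids (suc i , suc j , suc k , s<s i<j , s<s j<k ,
                   from (insert-mono-< j i) ρj<ρi , from (insert-mono-< i k) ρi<ρk) }) ,
      λ j k j<k ρj<v → ≰⇒> λ v≤ρk →
        avoids (zero , suc j , suc k , z<s , s<s j<k ,
                from (insert-< j ≤-refl) ρj<v , from (<-insert k) v≤ρk))
    λ { (avoids , cut) (zero , suc j , suc k , _ , j<k , πj<v , v<πk) →
          <⇒≱ (cut j k (s<s⁻¹ j<k) (to (insert-< j ≤-refl) πj<v)) (to (<-insert k) v<πk)
      ; (avoids , cut) (suc i , suc j , suc k , i<j , j<k , πj<πi , πi<πk) →
          avoids (i , j , k , s<s⁻¹ i<j , s<s⁻¹ j<k ,
                  to (insert-mono-< j i) πj<πi , to (insert-mono-< i k) πi<πk) }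

  -- By `cut-insert` the cuts of `π` counted here are the cuts of `ρ` up to and including `v`;
  -- `pred` discards `v` itself. What remains is the number of the cut `v` in the numbering from 0.
  cuts-insert : Cut ρ (toℕ v) → pred (cuts π) ≡ count (cut? ρ) (toℕ v)
  cuts-insert cut = begin
    pred (cuts π)                                      ≡⟨ cong pred truncated ⟩
    pred (count (cut? ρ) (toℕ v) + χ (cut? ρ (toℕ v))) ≡⟨ cong (λ c → pred (count (cut? ρ) (toℕ v) + c)) (χ-true (cut? ρ (toℕ v)) cut) ⟩
    pred (count (cut? ρ) (toℕ v) + 1)                  ≡⟨ cong pred (+-comm _ 1) ⟩
    count (cut? ρ) (toℕ v)                             ∎
    where
    open ≡-Reasoning
    truncated = count-truncate (cut? π) (cut? ρ) (toℕ v) (suc n) (toℕ<n v) cut-insert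

-- Ballot paths

last-vertices-⊕ : ∀ {n} x y u w (ss : Vec Point n) →
  last (vertices ((x , y) ⊕ (u , w)) ss) ≡ (x , y) ⊕ last (vertices (u , w) ss)
last-vertices-⊕ x y u w []             = refl
last-vertices-⊕ x y u w ((s , t) ∷ ss) = trans
  (cong (λ p → last (vertices p ss)) (cong₂ _,_ (ℤ.+-assoc x u s) (ℤ.+-assoc y w t)))
  (last-vertices-⊕ x y (u ℤ.+ s) (w ℤ.+ t) ss)

notBelowAxis-shift : ∀ {n} {x x′ y} (ss : Vec Point n) →
  All NotBelowAxis (vertices (x , y) ss) → All NotBelowAxis (vertices (x′ , y) ss)
notBelowAxis-shift []       (0≤y ∷ []) = 0≤y ∷ []
notBelowAxis-shift (s ∷ ss) (0≤y ∷ ps) = 0≤y ∷ notBelowAxis-shift ss ps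

head-vertices : ∀ {n} {P : Pred Point 0ℓ} {p} (ss : Vec Point n) → All P (vertices p ss) → P p
head-vertices []      (Pp ∷ _) = Pp
head-vertices (_ ∷ _) (Pp ∷ _) = Pp

BallotSteps : ∀ {n} → ℕ → ℕ → Pred (Vec Point n) 0ℓ
BallotSteps {n} h b ss =
  last (vertices (0ℤ , + h) ss) ≡ (+ n , + b) × All NotBelowAxis (vertices (0ℤ , + h) ss)

+1≡ : ∀ m → + m ℤ.+ 1ℤ ≡ + suc m
+1≡ m = cong +_ (+-comm m 1)

-- After its first step the path starts at abscissa 1. Translating by `(1ℤ , 0ℤ)` relates it to the
-- path from abscissa 0: endpoints shift along, and the axis condition ignores abscissas.
ballot-step : ∀ {n} t h h′ b (ss : Vec Point n) → + h ℤ.+ t ≡ + h′ →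
              BallotSteps h b ((1ℤ , t) ∷ ss) ⇔ BallotSteps h′ b ss
ballot-step {n} t h h′ b ss eq rewrite eq = mk⇔
  (λ { (end , _ ∷ above) →
    cong₂ _,_ (+ℤ-cancelˡ 1ℤ _ _ (cong proj₁ (trans (sym shift) end)))
              (+ℤ-cancelˡ 0ℤ _ _ (cong proj₂ (trans (sym shift) end))) ,
    notBelowAxis-shift ss above })
  (λ { (end , above) →
    trans shift (cong ((1ℤ , 0ℤ) ⊕_) end) , +≤+ z≤n ∷ notBelowAxis-shift ss above })
  where shift = last-vertices-⊕ 1ℤ 0ℤ 0ℤ (+ h′) ss

ballot-up : ∀ {n} h b (ss : Vec Point n) →
            BallotSteps h b ((1ℤ , 1ℤ) ∷ ss) ⇔ BallotSteps (suc h) b ss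
ballot-up h b ss = ballot-step 1ℤ h (suc h) b ss (+1≡ h)

ballot-down : ∀ {n} h b (ss : Vec Point n) →
              BallotSteps (suc h) b ((1ℤ , -1ℤ) ∷ ss) ⇔ BallotSteps h b ss
ballot-down h b ss = ballot-step -1ℤ (suc h) h b ss refl

¬ballot-down-0 : ∀ {n} b (ss : Vec Point n) → ¬ BallotSteps 0 b ((1ℤ , -1ℤ) ∷ ss)
¬ballot-down-0 b ss (_ , _ ∷ above) with head-vertices ss above
... | ()

module _ {n} (v : Fin (suc (suc n))) (ρ : Permutation′ (suc n)) where

  private
    π : Permutation′ (suc (suc n))
    π = insert zero v ρ

  ballotStep-insert-suc : ∀ i → ballotStep π (suc i) ≡ ballotStep ρ i
  ballotStep-insert-suc i = cong (if_then (1ℤ , 1ℤ) else (1ℤ , -1ℤ))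
    (does-⇔ (insert-mono-< v ρ (inject₁ i) (suc i)) (_ Fin.<? _) (_ Fin.<? _))

  -- The boolean `d` is abstract so that instantiating it with `true` or `false` makes the
  -- conditional compute to the up or down step.
  ballotStep-insert-zero : ∀ {d} → d ≡ does (toℕ v ≤? toℕ (ρ ⟨$⟩ʳ zero)) →
    ballotStep π zero ≡ (if d then (1ℤ , 1ℤ) else (1ℤ , -1ℤ))
  ballotStep-insert-zero eq = cong (if_then (1ℤ , 1ℤ) else (1ℤ , -1ℤ))
    (trans (does-⇔ (<-insert v ρ zero) (_ Fin.<? _) (toℕ v ≤? _)) (sym eq))

  ballotSteps-insert : ∀ {d} → d ≡ does (toℕ v ≤? toℕ (ρ ⟨$⟩ʳ zero)) →
    Vec.tabulate (ballotStep π)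
      ≡ (if d then (1ℤ , 1ℤ) else (1ℤ , -1ℤ)) ∷ Vec.tabulate (ballotStep ρ)
  ballotSteps-insert eq =
    cong₂ _∷_ (ballotStep-insert-zero eq) (tabulate-cong ballotStep-insert-suc)

  ballotSteps-insert-≤ : toℕ v ≤ toℕ (ρ ⟨$⟩ʳ zero) →
    Vec.tabulate (ballotStep π) ≡ (1ℤ , 1ℤ) ∷ Vec.tabulate (ballotStep ρ)
  ballotSteps-insert-≤ v≤ρ₀ = ballotSteps-insert (sym (dec-true (_ ≤? _) v≤ρ₀))

  ballotSteps-insert-> : toℕ (ρ ⟨$⟩ʳ zero) < toℕ v →
    Vec.tabulate (ballotStep π) ≡ (1ℤ , -1ℤ) ∷ Vec.tabulate (ballotStep ρ)
  ballotSteps-insert-> ρ₀<v = ballotSteps-insert (sym (dec-false (_ ≤? _) (<⇒≱ ρ₀<v)))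

  -- In both directions `v` is a cut of `ρ`, so `cut-≤-head` forces the new step to be an ascent.
  𝓑213-insert-ascent : ∀ h b → toℕ v < suc n →
    𝓑213 (suc n) h b π ⇔ (𝓑213 n (suc h) b ρ × Cut ρ (toℕ v))
  𝓑213-insert-ascent h b v<1+n = mk⇔
    (λ { (ballot , avoids) →
      let avoids′ , cut = to (avoids-insert v ρ) avoids
          steps = ballotSteps-insert-≤ (cut-≤-head ρ v<1+n cut)
      in (to (ballot-up h b _) (subst (BallotSteps h b) steps ballot) , avoids′) , cut })
    (λ { ((ballot , avoids) , cut) →
      let steps = ballotSteps-insert-≤ (cut-≤-head ρ v<1+n cut)
      in subst (BallotSteps h b) (sym steps) (from (ballot-up h b _) ballot) ,
         from (avoids-insert v ρ) (avoids , cut) })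

  module _ (v≡1+n : toℕ v ≡ suc n) where

    private
      steps : Vec.tabulate (ballotStep π) ≡ (1ℤ , -1ℤ) ∷ Vec.tabulate (ballotStep ρ)
      steps = ballotSteps-insert-> (≤-trans (toℕ<n _) (≤-reflexive (sym v≡1+n)))

    cut-max : Cut ρ (toℕ v)
    cut-max = subst (Cut ρ) (sym v≡1+n) (cut-n ρ)

    -- The largest value is a cut of every `ρ`, so the avoidance condition carries over without a
    -- further restriction.
    𝓑213-insert-descent : ∀ h b → 𝓑213 (suc n) (suc h) b π ⇔ 𝓑213 n h b ρ
    𝓑213-insert-descent h b = mk⇔
      (λ { (ballot , avoids) →
        to (ballot-down h b _) (subst (BallotSteps (suc h) b) steps ballot) ,
        proj₁ (to (avoids-insert v ρ) avoids) })
      (λ { (ballot , avoids) →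
        subst (BallotSteps (suc h) b) (sym steps) (from (ballot-down h b _) ballot) ,
        from (avoids-insert v ρ) (avoids , cut-max) })

    ¬𝓑213-insert-descent : ∀ b → ¬ 𝓑213 (suc n) 0 b π
    ¬𝓑213-insert-descent b (ballot , _) =
      ¬ballot-down-0 b _ (subst (BallotSteps 0 b) steps ballot)

-- The common recurrence

-- Height 0 admits no down step. At `k = 0` the second term is absent: for walks because `SW` would
-- leave the quadrant, for weights because `suc c C 0` equals `c C 0`.
down : (ℕ → ℕ → ℕ) → ℕ → ℕ → ℕ
down f zero    k       = 0
down f (suc h) zero    = f h 0
down f (suc h) (suc k) = f h (suc k) + f h k

down-cong : ∀ {f g} → (∀ h k → f h k ≡ g h k) → ∀ h k → down f h k ≡ down g h k
down-cong f≗g zero    k       = refl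
down-cong f≗g (suc h) zero    = f≗g h 0
down-cong f≗g (suc h) (suc k) = cong₂ _+_ (f≗g h (suc k)) (f≗g h k)

∑-down : ∀ (xs : List A) (f : ℕ → ℕ → A → ℕ) h k →
  ∑ xs (λ x → down (λ h k → f h k x) h k) ≡ down (λ h k → ∑ xs (f h k)) h k
∑-down xs f zero    k       = ∑-zero xs λ _ → refl
∑-down xs f (suc h) zero    = refl
∑-down xs f (suc h) (suc k) = ∑-+ xs (f h (suc k)) (f h k)

module _ (b : ℕ) where

  -- In the base case `0 C k` is the indicator of `k = 0`, written as the binomial coefficient
  -- carried by the one-letter permutation.
  Γ : ℕ → ℕ → ℕ → ℕ
  Γ zero    h k = χ (h ≟ b) * (0 C k)
  Γ (suc n) h k = (Γ n (suc h) k + Γ n (suc h) (suc k)) + down (Γ n) h k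

  -- Binomially weighted counts of permutations

  weight : ∀ n → ℕ → ℕ → Permutation′ (suc n) → ℕ
  weight n h k π = χ (𝓑213? n h b π) * (pred (cuts π) C k)

  weight-insert-ascent : ∀ {n} h k v (ρ : Permutation′ (suc n)) → toℕ v < suc n →
    weight (suc n) h k (insert zero v ρ)
      ≡ χ (𝓑213? n (suc h) b ρ) * (χ (cut? ρ (toℕ v)) * (count (cut? ρ) (toℕ v) C k))
  weight-insert-ascent {n} h k v ρ v<1+n = begin
    χ (𝓑213? (suc n) h b π) * (pred (cuts π) C k)
      ≡⟨ cong (_* (pred (cuts π) C k)) (χ-cong (𝓑213-insert-ascent v ρ h b v<1+n)
           (𝓑213? (suc n) h b π) (𝓑213? n (suc h) b ρ ×-dec cut? ρ (toℕ v))) ⟩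
    χ (𝓑213? n (suc h) b ρ ×-dec cut? ρ (toℕ v)) * (pred (cuts π) C k)
      ≡⟨ cong (_* (pred (cuts π) C k)) (χ-× (𝓑213? n (suc h) b ρ) (cut? ρ (toℕ v))) ⟩
    χ (𝓑213? n (suc h) b ρ) * χ (cut? ρ (toℕ v)) * (pred (cuts π) C k)
      ≡⟨ *-assoc (χ (𝓑213? n (suc h) b ρ)) _ _ ⟩
    χ (𝓑213? n (suc h) b ρ) * (χ (cut? ρ (toℕ v)) * (pred (cuts π) C k))
      -- The formula for `pred (cuts π)` needs `v` to be a cut, so it is applied under the indicator
      -- of that condition.
      ≡⟨ cong (χ (𝓑213? n (suc h) b ρ) *_)
           (χ-*-cong (cut? ρ (toℕ v)) (cong (_C k) ∘ cuts-insert v ρ)) ⟩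
    χ (𝓑213? n (suc h) b ρ) * (χ (cut? ρ (toℕ v)) * (count (cut? ρ) (toℕ v) C k)) ∎
    where
    open ≡-Reasoning
    π = insert zero v ρ

  ∑-weight-ascents : ∀ {n} h k (ρ : Permutation′ (suc n)) →
    ∑ (List.tabulate inject₁) (λ v → weight (suc n) h k (insert zero v ρ))
      ≡ weight n (suc h) k ρ + weight n (suc h) (suc k) ρ
  ∑-weight-ascents {n} h k ρ = begin
    ∑ (List.tabulate inject₁) (λ v → weight (suc n) h k (insert zero v ρ))
      ≡⟨ ∑-tabulate (suc n) inject₁ _ (λ u → w * (χ (cut? ρ u) * (count (cut? ρ) u C k))) pointwise ⟩
    ∑< (suc n) (λ u → w * (χ (cut? ρ u) * (count (cut? ρ) u C k)))
      ≡⟨ ∑<-*ˡ w (suc n) _ ⟩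
    w * ∑< (suc n) (λ u → χ (cut? ρ u) * (count (cut? ρ) u C k))
      ≡⟨ cong (w *_) (∑<-count-C (cut? ρ) k (suc n)) ⟩
    w * (cuts ρ C suc k)
      -- The hockey-stick sum involves `cuts ρ`, one more than the number used in `weight`; writing
      -- it as a successor lets Pascal's rule split it into two weights.
      ≡⟨ cong (λ c → w * (c C suc k)) (suc-pred-cuts ρ) ⟨
    w * (suc (pred (cuts ρ)) C suc k)
      ≡⟨ cong (w *_) (nCk+nC[k+1]≡[n+1]C[k+1] (pred (cuts ρ)) k) ⟨
    w * (pred (cuts ρ) C k + pred (cuts ρ) C suc k)
      ≡⟨ *-distribˡ-+ w _ _ ⟩
    weight n (suc h) k ρ + weight n (suc h) (suc k) ρ ∎
    where
    open ≡-Reasoning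
    w = χ (𝓑213? n (suc h) b ρ)
    pointwise : ∀ i → weight (suc n) h k (insert zero (inject₁ i) ρ)
                        ≡ w * (χ (cut? ρ (toℕ i)) * (count (cut? ρ) (toℕ i) C k))
    pointwise i = subst
      (λ u → weight (suc n) h k (insert zero (inject₁ i) ρ)
               ≡ w * (χ (cut? ρ u) * (count (cut? ρ) u C k)))
      (toℕ-inject₁ i)
      (weight-insert-ascent h k (inject₁ i) ρ
        (subst (_< suc n) (sym (toℕ-inject₁ i)) (toℕ<n i)))

  -- Prepending the largest value preserves every cut and adds one to their number. Pascal's rule
  -- expands the resulting binomial coefficient into the terms of `down`.
  weight-insert-descent : ∀ {n} h k (ρ : Permutation′ (suc n)) →
    weight (suc n) h k (insert zero (fromℕ (suc n)) ρ) ≡ down (λ h k → weight n h k ρ) h k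
  weight-insert-descent {n} zero k ρ = cong (_* _)
    (χ-false (𝓑213? (suc n) 0 b (insert zero (fromℕ (suc n)) ρ))
             (¬𝓑213-insert-descent (fromℕ (suc n)) ρ (toℕ-fromℕ (suc n)) b))
  weight-insert-descent {n} (suc h) k ρ = begin
    weight (suc n) (suc h) k π                ≡⟨ cong₂ (λ w c → w * (c C k)) ballot all-cuts ⟩
    w * (suc (pred (cuts ρ)) C k)             ≡⟨ pascal k ⟩
    down (λ h k → weight n h k ρ) (suc h) k   ∎
    where
    open ≡-Reasoning
    v = fromℕ (suc n)
    π = insert zero v ρ
    v≡1+n = toℕ-fromℕ (suc n)
    w = χ (𝓑213? n h b ρ)
    ballot : χ (𝓑213? (suc n) (suc h) b π) ≡ w
    ballot = χ-cong (𝓑213-insert-descent v ρ v≡1+n h b) (𝓑213? (suc n) (suc h) b π) (𝓑213? n h b ρ)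
    all-cuts : pred (cuts π) ≡ suc (pred (cuts ρ))
    all-cuts = trans (cuts-insert v ρ (cut-max v ρ v≡1+n))
                     (trans (cong (count (cut? ρ)) v≡1+n) (sym (suc-pred-cuts ρ)))
    pascal : ∀ k → w * (suc (pred (cuts ρ)) C k) ≡ down (λ h k → weight n h k ρ) (suc h) k
    pascal zero    = cong (w *_) (trans (nC0≡1 (suc (pred (cuts ρ)))) (sym (nC0≡1 (pred (cuts ρ)))))
    pascal (suc k) = begin
      w * (suc (pred (cuts ρ)) C suc k)               ≡⟨ cong (w *_) (nCk+nC[k+1]≡[n+1]C[k+1] _ k) ⟨
      w * (pred (cuts ρ) C k + pred (cuts ρ) C suc k) ≡⟨ *-distribˡ-+ w _ _ ⟩
      weight n h k ρ + weight n h (suc k) ρ           ≡⟨ +-comm (weight n h k ρ) _ ⟩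
      weight n h (suc k) ρ + weight n h k ρ           ∎

  ∑-weight-insert : ∀ {n} h k (ρ : Permutation′ (suc n)) →
    ∑ (allFin (2 + n)) (λ v → weight (suc n) h k (insert zero v ρ))
      ≡ (weight n (suc h) k ρ + weight n (suc h) (suc k) ρ) + down (λ h k → weight n h k ρ) h k
  ∑-weight-insert {n} h k ρ = trans
    (∑-tabulate-last (suc n) id (λ v → weight (suc n) h k (insert zero v ρ)))
    (cong₂ _+_ (∑-weight-ascents h k ρ) (weight-insert-descent h k ρ))

  ∑-weight≡Γ : ∀ n h k → ∑ (allPermutations (suc n)) (weight n h k) ≡ Γ n h k
  ∑-weight≡Γ zero h k = trans (+-identityʳ _)
    (cong₂ (λ w c → w * (c C k))
      (χ-cong (mk⇔ to′ from′) (𝓑213? 0 h b π) (h ≟ b))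
      -- The one-letter permutation has the single counted cut 0, so its binomial coefficient is
      -- `0 C k`.
      (cong pred (χ-true (cut? π 0) (cut-0 π))))
    where
    π : Permutation′ 1
    π = insert zero zero idₚ
    to′ : 𝓑213 0 h b π → h ≡ b
    to′ ((end , _) , _) = ℤ.+-injective (cong proj₂ end)
    from′ : h ≡ b → 𝓑213 0 h b π
    from′ refl = (refl , +≤+ z≤n ∷ []) , λ { (zero , zero , _ , () , _) }
  ∑-weight≡Γ (suc n) h k = begin
    ∑ (allPermutations (2 + n)) (weight (suc n) h k)
      ≡⟨ ∑-cartesianProductWith (insert zero) (allFin (2 + n)) ρs ⟩
    ∑ (allFin (2 + n)) (λ v → ∑ ρs (λ ρ → weight (suc n) h k (insert zero v ρ)))
      -- With `ρ` fixed outside, the inner sum runs over all values prepended to it.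
      ≡⟨ ∑-comm (allFin (2 + n)) ρs _ ⟩
    ∑ ρs (λ ρ → ∑ (allFin (2 + n)) (λ v → weight (suc n) h k (insert zero v ρ)))
      ≡⟨ ∑-cong ρs (∑-weight-insert h k) ⟩
    ∑ ρs (λ ρ → (weight n (suc h) k ρ + weight n (suc h) (suc k) ρ)
                  + down (λ h k → weight n h k ρ) h k)
      ≡⟨ ∑-+ ρs (λ ρ → weight n (suc h) k ρ + weight n (suc h) (suc k) ρ) _ ⟩
    ∑ ρs (λ ρ → weight n (suc h) k ρ + weight n (suc h) (suc k) ρ)
      + ∑ ρs (λ ρ → down (λ h k → weight n h k ρ) h k)
      ≡⟨ cong₂ _+_ (∑-+ ρs (weight n (suc h) k) (weight n (suc h) (suc k)))
                   (∑-down ρs (weight n) h k) ⟩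
    (∑ ρs (weight n (suc h) k) + ∑ ρs (weight n (suc h) (suc k)))
      + down (λ h k → ∑ ρs (weight n h k)) h k
      ≡⟨ cong₂ _+_ (cong₂ _+_ (∑-weight≡Γ n (suc h) k) (∑-weight≡Γ n (suc h) (suc k)))
                   (down-cong (∑-weight≡Γ n) h k) ⟩
    Γ (suc n) h k ∎
    where
    open ≡-Reasoning
    ρs = allPermutations (suc n)

  -- Counts of Gessel walks

  Gessel : ∀ {n} → Point → Pred (Vec GesselStep n) 0ℓ
  Gessel p ss = last (vertices p (Vec.map ⟦_⟧ ss)) ≡ (0ℤ , + b)
              × All InQuadrant (vertices p (Vec.map ⟦_⟧ ss))

  gessel? : ∀ {n} p → Decidable (Gessel {n} p)
  gessel? p ss = last (vertices p (Vec.map ⟦_⟧ ss)) ≟ₚ (0ℤ , + b)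
           ×-dec All.all? inQuadrant? (vertices p (Vec.map ⟦_⟧ ss))

  -- Any integer point may be the start, even one outside the quadrant, so all four first steps are
  -- handled uniformly and forbidden ones contribute 0.
  gesselCount : ℕ → Point → ℕ
  gesselCount n p = ∑ (allStepWords n) (χ ∘ gessel? p)

  gesselCount-outside : ∀ n {p} → ¬ InQuadrant p → gesselCount n p ≡ 0
  gesselCount-outside n {p} p∉ = ∑-zero (allStepWords n) λ ss →
    χ-false (gessel? p ss) (p∉ ∘ head-vertices (Vec.map ⟦_⟧ ss) ∘ proj₂)

  gesselCount-suc : ∀ n {p} → InQuadrant p →
    gesselCount (suc n) p ≡ ∑ allSteps (λ s → gesselCount n (p ⊕ ⟦ s ⟧))
  gesselCount-suc n {p} p∈ = trans
    (∑-cartesianProductWith _∷_ allSteps (allStepWords n))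
    (∑-cong allSteps λ s → ∑-cong (allStepWords n) λ ss →
      χ-cong (mk⇔ (λ { (end , _ ∷ inside) → end , inside })
                  (λ { (end , inside) → end , p∈ ∷ inside }))
             (gessel? p (s ∷ ss)) (gessel? (p ⊕ ⟦ s ⟧) ss))

  gesselCount≡Γ : ∀ n h k → gesselCount n (+ k , + h) ≡ Γ n h k
  gesselCount≡Γ zero h zero = trans (+-identityʳ _) (trans
    (χ-cong (mk⇔ (ℤ.+-injective ∘ cong proj₂ ∘ proj₁)
                 (λ { refl → refl , (+≤+ z≤n , +≤+ z≤n) ∷ [] }))
            (gessel? (0ℤ , + h) []) (h ≟ b))
    (sym (*-identityʳ _)))
  -- An empty walk starting off the vertical axis cannot end on it, in agreement with `0 C suc k`
  -- being 0.
  gesselCount≡Γ zero h (suc k) = trans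
    (cong (_+ 0) (χ-false (gessel? (+ suc k , + h) []) λ { (() , _) }))
    (sym (*-zeroʳ (χ (h ≟ b))))
  gesselCount≡Γ (suc n) h k = begin
    gesselCount (suc n) (+ k , + h)
      ≡⟨ gesselCount-suc n (+≤+ z≤n , +≤+ z≤n) ⟩
    north + (south + (northeast + (southwest + 0)))
      ≡⟨ rearrange ⟩
    (north + northeast) + (south + southwest)
      ≡⟨ cong₂ _+_ (cong₂ _+_ north≡ northeast≡) (down≡ h k) ⟩
    Γ (suc n) h k ∎
    where
    open ≡-Reasoning
    north     = gesselCount n ((+ k , + h) ⊕ ⟦ N ⟧)
    south     = gesselCount n ((+ k , + h) ⊕ ⟦ S ⟧)
    northeast = gesselCount n ((+ k , + h) ⊕ ⟦ NE ⟧)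
    southwest = gesselCount n ((+ k , + h) ⊕ ⟦ SW ⟧)
    rearrange : north + (south + (northeast + (southwest + 0)))
                  ≡ (north + northeast) + (south + southwest)
    rearrange rewrite +-identityʳ southwest =
      trans (sym (+-assoc north _ _)) (interchange north south northeast southwest)
    north≡ : north ≡ Γ n (suc h) k
    north≡ = trans (cong (gesselCount n) (cong₂ _,_ (ℤ.+-identityʳ (+ k)) (+1≡ h)))
                   (gesselCount≡Γ n (suc h) k)
    northeast≡ : northeast ≡ Γ n (suc h) (suc k)
    northeast≡ = trans (cong (gesselCount n) (cong₂ _,_ (+1≡ k) (+1≡ h)))
                       (gesselCount≡Γ n (suc h) (suc k))
    down≡ : ∀ h k → gesselCount n ((+ k , + h) ⊕ ⟦ S ⟧) + gesselCount n ((+ k , + h) ⊕ ⟦ SW ⟧)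
                      ≡ down (Γ n) h k
    -- From height 0, both `S` and `SW` lead to ordinate -1.
    down≡ zero k = cong₂ _+_ (gesselCount-outside n λ { (_ , ()) })
                             (gesselCount-outside n λ { (_ , ()) })
    down≡ (suc h) zero = trans
      (cong₂ _+_ (gesselCount≡Γ n h 0) (gesselCount-outside n λ { (() , _) }))
      (+-identityʳ _)
    down≡ (suc h) (suc k) = cong₂ _+_
      (trans (cong (λ x → gesselCount n (x , + h)) (ℤ.+-identityʳ (+ suc k))) (gesselCount≡Γ n h (suc k)))
      (gesselCount≡Γ n h k)

theorem4p2 : (n h b : ℕ) → E n h b ≡ F n h b
theorem4p2 n h b = begin
  E n h b
    ≡⟨ length-filter-∑ (𝓑213? n h b) (allPermutations (suc n)) ⟩
  ∑ (allPermutations (suc n)) (χ ∘ 𝓑213? n h b)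
    -- At `k = 0` the binomial factor is 1, so the plain count is a weighted one.
    ≡⟨ ∑-cong (allPermutations (suc n)) (λ π →
         trans (sym (*-identityʳ _)) (cong (χ (𝓑213? n h b π) *_) (sym (nC0≡1 (pred (cuts π)))))) ⟩
  ∑ (allPermutations (suc n)) (weight b n h 0)
    ≡⟨ ∑-weight≡Γ b n h 0 ⟩
  Γ b n h 0
    ≡⟨ gesselCount≡Γ b n h 0 ⟨
  gesselCount b n (0ℤ , + h)
    ≡⟨ length-filter-∑ (𝓖? n h b) (allStepWords n) ⟨
  F n h b ∎
  where open ≡-Reasoning
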